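{- Let $r \ge 3$ be an integer and let $H$ be an intersecting $r$-segment hypergraph. Then $H$ contains an isolated vertex, i.e. a vertex lying in only one edge of $H$. In particular, $\tau(H) \le r-1$.
   Context: A hypergraph $H=(V,E)$ consists of a vertex set $V$ and an edge set $E \subset 2^V$. For an integer $r \ge 2$, a hypergraph $H=(V,E)$ with $V \subset \mathbb{Z}^2$ is an $r$-segment hypergraph if (i) every edge in $E$ consists of $r$ consecutive integer points (points of $\mathbb{Z}^2$) on some line in $\mathbb{R}^2$, and (ii) every line in $\mathbb{R}^2$ contains at most one edge of $H$. The matching number $\nu(H)$ is the maximum number of pairwise disjoint edges of $H$; $H$ is intersecting if $\nu(H)=1$ (so $H$ has at least one edge and any two edges share a vertex). A cover of $H$ is a set of vertices meeting every edge; the covering number $\tau(H)$ is the minimum size of a cover. An isolated vertex is a vertex lying in exactly one edge. -}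

module Defs where

open import Data.Integer using (ℤ; +_; _+_; _*_; 0ℤ)
open import Data.List using (List; length)
open import Data.List.Membership.Propositional using () renaming (_∈_ to _∈ₗ_)
open import Data.List.Relation.Unary.All using (All)
open import Data.List.Relation.Unary.AllPairs using (AllPairs)
open import Data.List.Relation.Unary.Unique.Propositional using (Unique)
open import Data.Nat as ℕ using (ℕ; _≤_; _<_)
open import Data.Product using (∃; ∃₂; _×_; _,_)
open import Function.Bundles using (_⇔_)
open import Level using (0ℓ; suc)
open import Relation.Binary.Definitions using (_Respects_)
open import Relation.Binary.PropositionalEquality using (_≡_)
open import Relation.Nullary using (¬_)
open import Relation.Unary using (Pred; _∈_; _⊆_; _≐_; _≬_; _⊥_)

-- Subsets are predicates, and two subsets are regarded as equal when they have
-- the same elements (_≐_).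

HasSize : {X : Set} → Pred X 0ℓ → ℕ → Set
HasSize {X} P n =
  ∃ λ (xs : List X) → Unique xs × length xs ≡ n × (∀ x → (x ∈ P) ⇔ (x ∈ₗ xs))

-- Neither V nor E is assumed finite.
record Hypergraph (X : Set) : Set₂ where
  field
    V        : Pred X 0ℓ
    E        : Pred (Pred X 0ℓ) (suc 0ℓ)
    E-resp-≐ : E Respects _≐_
    E⊆2^V    : ∀ {e} → e ∈ E → e ⊆ V

module _ {X : Set} (H : Hypergraph X) where
  open Hypergraph H

  -- A matching is listed without repetition.  Distinctness has to be required
  -- separately because the empty set is disjoint from itself.
  IsMatching : List (Pred X 0ℓ) → Set₁
  IsMatching M = All E M × AllPairs (λ e f → ¬ (e ≐ f) × e ⊥ f) M

  IsMatchingNumber : ℕ → Set₁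
  IsMatchingNumber n =
    (∃ λ M → IsMatching M × length M ≡ n) × (∀ M → IsMatching M → length M ≤ n)

  Intersecting : Set₁
  Intersecting = IsMatchingNumber 1

  IsCover : Pred X 0ℓ → Set₁
  IsCover C = C ⊆ V × (∀ {e} → e ∈ E → C ≬ e)

  IsCoveringNumber : ℕ → Set₁
  IsCoveringNumber t =
    (∃ λ C → IsCover C × HasSize C t) × (∀ C k → IsCover C → HasSize C k → t ≤ k)

  IsIsolated : X → Set₁
  IsIsolated v =
    v ∈ V × (∃ λ e → e ∈ E × v ∈ e × (∀ {f} → f ∈ E → v ∈ f → f ≐ e))

ℤ² : Set
ℤ² = ℤ × ℤ

-- The line { (x , y) ∈ ℝ² ∣ a x + b y = c }.  A line of ℝ² containing two
-- distinct integer points has such an equation with integer coefficients, and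
-- any other line contains at most one integer point, so for r ≥ 2 no other line
-- contains r integer points.
record Line : Set where
  field
    a b c         : ℤ
    nondegenerate : ¬ (a ≡ 0ℤ × b ≡ 0ℤ)

latticePoints : Line → Pred ℤ² 0ℓ
latticePoints L (x , y) = a * x + b * y ≡ c
  where open Line L

-- q = (m p + n s) / (m + n) for some weights m, n ≥ 0, not both zero: q lies on
-- the closed segment from p to s (for integer points, rational weights suffice).
Between : ℤ² → ℤ² → ℤ² → Set
Between (p₁ , p₂) (q₁ , q₂) (s₁ , s₂) = ∃₂ λ (m n : ℕ) →
  0 < m ℕ.+ n ×
  + (m ℕ.+ n) * q₁ ≡ + m * p₁ + + n * s₁ ×
  + (m ℕ.+ n) * q₂ ≡ + m * p₂ + + n * s₂

-- Consecutive means that no integer point is skipped: every integer point of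
-- the line lying between two points of e is in e.
AreConsecutiveOn : ℕ → Line → Pred ℤ² 0ℓ → Set
AreConsecutiveOn r L e =
  e ⊆ latticePoints L ×
  HasSize e r ×
  (∀ {p q s} → p ∈ e → s ∈ e → q ∈ latticePoints L → Between p q s → q ∈ e)

-- Meant for r ≥ 2, where restricting to lines with integer coefficients loses
-- nothing.
record IsSegmentHypergraph (r : ℕ) (H : Hypergraph ℤ²) : Set₁ where
  open Hypergraph H
  field
    edge-consecutive : ∀ {e} → e ∈ E → ∃ λ L → AreConsecutiveOn r L e
    line-unique      : ∀ (L : Line) {e f} → e ∈ E → f ∈ E →
                       e ⊆ latticePoints L → f ⊆ latticePoints L → e ≐ f

{-# OPTIONS --safe #-}
module Submission where

open import Axiom.ExcludedMiddle using (ExcludedMiddle)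
open import Data.Empty using (⊥; ⊥-elim)
open import Data.Integer using (ℤ; +_; -[1+_]; _+_; _*_; _-_; -_; 0ℤ; 1ℤ; ∣_∣)
open import Data.Integer.Divisibility.Signed using (divides; ∣ᵤ⇒∣)
import Data.Integer.Properties as ℤ
open import Data.Integer.Tactic.RingSolver using (solve-∀)
open import Data.List using ([]; _∷_; length; filter)
open import Data.List.Membership.Propositional using () renaming (_∈_ to _∈ₗ_)
open import Data.List.Membership.Propositional.Properties using (∈-filter⁺; ∈-filter⁻)
open import Data.List.Properties using (filter-notAll)
open import Data.List.Relation.Unary.All using ([]; _∷_)
open import Data.List.Relation.Unary.AllPairs using ([]; _∷_)
open import Data.List.Relation.Unary.Any as Any using (Any; here; there)
open import Data.List.Relation.Unary.Unique.Propositional using (Unique)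
import Data.List.Relation.Unary.Unique.Propositional.Properties as Unique
open import Data.Nat using (ℕ; _≤_; _∸_)
import Data.Nat as ℕ
open import Data.Nat.Divisibility using (∣⇒≤) renaming (divides to divides-ℕ)
open import Data.Nat.GCD using (GCD; module Bézout)
open import Data.Nat.Induction using (<-rec)
import Data.Nat.Properties as ℕ
open import Data.Product using (∃; _×_; _,_; proj₁; proj₂)
open import Data.Product.Properties using (≡-dec)
open import Data.Sum using (_⊎_; inj₁; inj₂; [_,_]′)
open import Function.Bundles using (_⇔_; mk⇔; Equivalence)
open import Level using (0ℓ; suc; lift; lower)
open import Relation.Binary.PropositionalEquality
  using (_≡_; _≢_; refl; sym; trans; cong; cong₂; subst; module ≡-Reasoning)
open import Relation.Nullary using (¬_; Dec; yes; no)
open import Relation.Nullary.Decidable using (map′; decidable-stable; ¬?)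
open import Relation.Unary using (Pred; _∈_; _∉_; _⊆_; _≐_; _≬_)
open import Defs

-- Suppose that every point of an edge lies on a second edge, and let e and f be
-- distinct edges whose steps u and v have the least value of |det u v|.  Let p be
-- their common point.  By minimality an edge through p + v other than f leads
-- from there to e in a single step of its own; since all crossings are lattice
-- points, this produces (after changing signs) an edge with step v − u through
-- p + u and p + v.  So p, p + u, p + v is a triangle of single steps, and the same
-- applies to the minimal pairs at its three corners.  Triangles cannot occur in
-- opposite quadrants at a corner, because their third sides would be parallel;
-- hence at each corner one of the two edges ends.  As every edge has a third
-- point, each one leaves the triangle at exactly one corner, as in a pinwheel.
-- The triangles built on two of these extensions have sides with steps 2u − v
-- and −u − v which would have to meet at a third of a step.

-- Least elements and vectors of the integer plane.

least : ∀ {ℓ} → ExcludedMiddle ℓ → (P : ℕ → Set ℓ) → ∃ P →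
        ∃ λ n → P n × (∀ m → P m → n ≤ m)
least em P (n , pn) = <-rec Goal step n pn
  where
  Goal : ℕ → Set _
  Goal n = P n → ∃ λ n → P n × (∀ m → P m → n ≤ m)
  step : ∀ n → (∀ {m} → m ℕ.< n → Goal m) → Goal n
  step n rec pn with em {∃ λ m → m ℕ.< n × P m}
  ... | yes (m , m<n , pm) = rec m<n pm
  ... | no none = n , pn , λ m pm → ℕ.≮⇒≥ (λ m<n → none (m , m<n , pm))

infixl 6 _⊕_
infixl 7 _⊙_
infix 8 ⊝_

_⊕_ : ℤ² → ℤ² → ℤ²
p ⊕ q = proj₁ p + proj₁ q , proj₂ p + proj₂ q

_⊙_ : ℤ → ℤ² → ℤ²
k ⊙ p = k * proj₁ p , k * proj₂ p

⊝_ : ℤ² → ℤ²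
⊝ p = - proj₁ p , - proj₂ p

𝟘 : ℤ²
𝟘 = 0ℤ , 0ℤ

det : ℤ² → ℤ² → ℤ
det u v = proj₁ u * proj₂ v - proj₂ u * proj₁ v

_≟_ : (p q : ℤ²) → Dec (p ≡ q)
_≟_ = ≡-dec ℤ._≟_ ℤ._≟_

componentwise₂ : ∀ {f g : ℤ → ℤ → ℤ} → (∀ x y → f x y ≡ g x y) → ∀ (p q : ℤ²) →
  (f (proj₁ p) (proj₁ q) , f (proj₂ p) (proj₂ q)) ≡ (g (proj₁ p) (proj₁ q) , g (proj₂ p) (proj₂ q))
componentwise₂ h p q = cong₂ _,_ (h (proj₁ p) (proj₁ q)) (h (proj₂ p) (proj₂ q))

componentwise₃ : ∀ {f g : ℤ → ℤ → ℤ → ℤ} → (∀ x y z → f x y z ≡ g x y z) → ∀ (p q r : ℤ²) →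
  (f (proj₁ p) (proj₁ q) (proj₁ r) , f (proj₂ p) (proj₂ q) (proj₂ r)) ≡
  (g (proj₁ p) (proj₁ q) (proj₁ r) , g (proj₂ p) (proj₂ q) (proj₂ r))
componentwise₃ h p q r =
  cong₂ _,_ (h (proj₁ p) (proj₁ q) (proj₁ r)) (h (proj₂ p) (proj₂ q) (proj₂ r))

⊕-⊝-cancel : ∀ p d → p ⊕ d ⊕ ⊝ d ≡ p
⊕-⊝-cancel = componentwise₂ id₁
  where
  id₁ : ∀ p d → p + d + - d ≡ p
  id₁ = solve-∀

⊕-inverse : ∀ p → p ⊕ ⊝ p ≡ 𝟘
⊕-inverse p = cong₂ _,_ (ℤ.+-inverseʳ (proj₁ p)) (ℤ.+-inverseʳ (proj₂ p))

⊕-fixed : ∀ p v → p ⊕ v ≡ p → v ≡ 𝟘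
⊕-fixed p v eq = trans (componentwise₂ id₁ p v) (trans (cong (_⊕ ⊝ p) eq) (⊕-inverse p))
  where
  id₁ : ∀ p v → v ≡ p + v + - p
  id₁ = solve-∀

⊝-involutive : ∀ d → ⊝ ⊝ d ≡ d
⊝-involutive d = cong₂ _,_ (ℤ.neg-involutive _) (ℤ.neg-involutive _)

⊙-identity : ∀ d → 1ℤ ⊙ d ≡ d
⊙-identity d = cong₂ _,_ (ℤ.*-identityˡ _) (ℤ.*-identityˡ _)

⊕-identity : ∀ p d → p ⊕ 0ℤ ⊙ d ≡ p
⊕-identity p d = cong₂ _,_ (ℤ.+-identityʳ (proj₁ p)) (ℤ.+-identityʳ (proj₂ p))

*-nonzero : ∀ k {m} → m ≢ 0ℤ → k * m ≡ 0ℤ → k ≡ 0ℤ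
*-nonzero k m≢0 eq = [ (λ k≡0 → k≡0) , (λ m≡0 → ⊥-elim (m≢0 m≡0)) ]′ (ℤ.i*j≡0⇒i≡0∨j≡0 k eq)

-- Cramer's rule: the determinants of the relation with v and of u with the relation are
-- `x * det u v` and `y * det u v`.
independent : ∀ {u v} → det u v ≢ 0ℤ → ∀ x y → x ⊙ u ⊕ y ⊙ v ≡ 𝟘 → x ≡ 0ℤ × y ≡ 0ℤ
independent {u₁ , u₂} {v₁ , v₂} D≢0 x y eq =
  *-nonzero x D≢0 (trans (id₁ x y u₁ u₂ v₁ v₂) (zero v₂ v₁)) ,
  *-nonzero y D≢0 (trans (id₂ x y u₁ u₂ v₁ v₂) (zero′ u₁ u₂))
  where
  id₁ : ∀ x y u₁ u₂ v₁ v₂ → x * (u₁ * v₂ - u₂ * v₁) ≡ (x * u₁ + y * v₁) * v₂ - (x * u₂ + y * v₂) * v₁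
  id₁ = solve-∀
  id₂ : ∀ x y u₁ u₂ v₁ v₂ → y * (u₁ * v₂ - u₂ * v₁) ≡ u₁ * (x * u₂ + y * v₂) - u₂ * (x * u₁ + y * v₁)
  id₂ = solve-∀
  zero : ∀ s t → (x * u₁ + y * v₁) * s - (x * u₂ + y * v₂) * t ≡ 0ℤ
  zero s t rewrite cong proj₁ eq | cong proj₂ eq = refl
  zero′ : ∀ s t → s * (x * u₂ + y * v₂) - t * (x * u₁ + y * v₁) ≡ 0ℤ
  zero′ s t rewrite cong proj₁ eq | cong proj₂ eq | ℤ.*-zeroʳ s | ℤ.*-zeroʳ t = refl

-- Segments as intervals of arithmetic progressions.

-- Keeps what the combinatorial argument uses of an edge, without its line or the exact count r.
-- Together the fields make e an interval of a progression with step d, which determines d up to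
-- sign.
record Segment (e : Pred ℤ² 0ℓ) (d : ℤ²) : Set where
  field
    along  : ∀ {p q} → p ∈ e → q ∈ e → ∃ λ k → q ≡ p ⊕ k ⊙ d
    convex : ∀ {p} m n → p ∈ e → p ⊕ (+ (m ℕ.+ n)) ⊙ d ∈ e → p ⊕ (+ m) ⊙ d ∈ e
    -- That is, e has at least three points.
    avoid  : ∀ p q → ∃ λ s → s ∈ e × s ≢ p × s ≢ q

open Segment

module _ {e : Pred ℤ² 0ℓ} where

  Segment-⊝ : ∀ {d} → Segment e d → Segment e (⊝ d)
  Segment-⊝ {d} S .along {p} {q} p∈e q∈e with along S p∈e q∈e
  ... | k , eq = - k , trans eq (componentwise₂ (id₁ k) p d)
    where
    id₁ : ∀ k p d → p + k * d ≡ p + - k * - d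
    id₁ = solve-∀
  -- The same interval is read from its other end, so m and n change places.
  Segment-⊝ {d} S .convex {p} m n p∈e q∈e =
    subst (_∈ e) (componentwise₂ (id₁ (+ m) (+ n)) p d)
      (convex S n m q∈e (subst (_∈ e) (componentwise₂ (id₂ (+ m) (+ n)) p d) p∈e))
    where
    id₁ : ∀ m n p d → p + (m + n) * - d + n * d ≡ p + m * - d
    id₁ = solve-∀
    id₂ : ∀ m n p d → p ≡ p + (m + n) * - d + (n + m) * d
    id₂ = solve-∀
  Segment-⊝ S .avoid = avoid S

  module _ {d} (S : Segment e d) where

    step-nonzero : d ≢ 𝟘
    step-nonzero refl with avoid S 𝟘 𝟘
    ... | p , p∈e , _ with avoid S p p
    ... | q , q∈e , q≢p , _ with along S p∈e q∈e
    ... | k , q≡ = q≢p (trans q≡ (componentwise₂ (λ x _ → id₁ x k) p 𝟘))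
      where
      id₁ : ∀ p k → p + k * 0ℤ ≡ p
      id₁ = solve-∀

    convex-first : ∀ {p} n → p ∈ e → p ⊕ (+ ℕ.suc n) ⊙ d ∈ e → p ⊕ d ∈ e
    convex-first {p} n p∈e q∈e =
      subst (λ x → p ⊕ x ∈ e) (⊙-identity d) (convex S 1 n p∈e q∈e)

  -- Another point of e lies k steps from p with k nonzero, and `convex` supplies the first of these
  -- steps.
  neighbour : ∀ {d} → Segment e d → ∀ {p} → p ∈ e → p ⊕ d ∈ e ⊎ p ⊕ ⊝ d ∈ e
  neighbour {d} S {p} p∈e with avoid S p p
  ... | q , q∈e , q≢p , _ with along S p∈e q∈e
  ... | + 0 , eq = ⊥-elim (q≢p (trans eq (⊕-identity p d)))
  ... | + ℕ.suc n , eq = inj₁ (convex-first S n p∈e (subst (_∈ e) eq q∈e))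
  ... | -[1+ n ] , eq =
    inj₂ (convex-first (Segment-⊝ S) n p∈e
      (subst (_∈ e) (trans eq (componentwise₂ (id₁ (+ ℕ.suc n)) p d)) q∈e))
    where
    id₁ : ∀ k p d → p + - k * d ≡ p + k * - d
    id₁ = solve-∀

  -- A third point lies k steps from p with k neither 0 nor 1, so `convex` reaches either the step
  -- before p or the step after `p ⊕ d`.
  extend : ∀ {d} → Segment e d → ∀ {p} → p ∈ e → p ⊕ d ∈ e →
           p ⊕ ⊝ d ∈ e ⊎ p ⊕ d ⊕ d ∈ e
  extend {d} S {p} p∈e p′∈e with avoid S p (p ⊕ d)
  ... | q , q∈e , q≢p , q≢p′ with along S p∈e q∈e
  ... | + 0 , eq = ⊥-elim (q≢p (trans eq (⊕-identity p d)))
  ... | + 1 , eq = ⊥-elim (q≢p′ (trans eq (cong (p ⊕_) (⊙-identity d))))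
  ... | + ℕ.suc (ℕ.suc n) , eq =
    inj₂ (convex-first S n p′∈e
      (subst (_∈ e) (trans eq (componentwise₂ (id₁ (+ ℕ.suc n)) p d)) q∈e))
    where
    id₁ : ∀ k p d → p + (1ℤ + k) * d ≡ p + d + k * d
    id₁ = solve-∀
  ... | -[1+ n ] , eq =
    inj₁ (convex-first (Segment-⊝ S) n p∈e
      (subst (_∈ e) (trans eq (componentwise₂ (id₁ (+ ℕ.suc n)) p d)) q∈e))
    where
    id₁ : ∀ k p d → p + - k * d ≡ p + k * - d
    id₁ = solve-∀

-- The primitive direction of a lattice line.

∣_∣-multiple : ∀ i → ∃ λ ε → + ∣ i ∣ ≡ ε * i
∣ + n ∣-multiple = 1ℤ , sym (ℤ.*-identityˡ _)
∣ -[1+ n ] ∣-multiple = - 1ℤ , sym (ℤ.-1*i≡-i -[1+ n ])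

bézout : ∀ a b → ∃ λ d → ∃ λ a′ → ∃ λ b′ → ∃ λ x → ∃ λ y →
         a ≡ a′ * d × b ≡ b′ * d × d ≡ x * a + y * b
bézout a b with Bézout.lemma ∣ a ∣ ∣ b ∣
... | Bézout.result d g B with ∣ᵤ⇒∣ {+ d} {a} (proj₁ (GCD.commonDivisor g))
                             | ∣ᵤ⇒∣ {+ d} {b} (proj₂ (GCD.commonDivisor g))
... | divides a′ a≡ | divides b′ b≡ = + d , a′ , b′ , combination B
  where
  α = proj₁ ∣ a ∣-multiple
  β = proj₁ ∣ b ∣-multiple
  shift : ∀ d y b x a → d + y * b ≡ x * a → d ≡ x * a - y * b
  shift d y b x a eq = trans (id₁ d (y * b)) (cong (_- y * b) eq)
    where
    id₁ : ∀ d z → d ≡ d + z - z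
    id₁ = solve-∀
  toℤ : ∀ d y b x a → d ℕ.+ y ℕ.* b ≡ x ℕ.* a → + d + + y * + b ≡ + x * + a
  toℤ d y b x a eq = begin
    + d + + y * + b    ≡⟨ cong (λ z → + d + z) (sym (ℤ.pos-* y b)) ⟩
    + (d ℕ.+ y ℕ.* b)  ≡⟨ cong +_ eq ⟩
    + (x ℕ.* a)        ≡⟨ ℤ.pos-* x a ⟩
    + x * + a          ∎
    where open ≡-Reasoning
  combination : Bézout.Identity d ∣ a ∣ ∣ b ∣ →
                ∃ λ x → ∃ λ y → a ≡ a′ * + d × b ≡ b′ * + d × + d ≡ x * a + y * b
  combination (Bézout.+- x y eq) = + x * α , - + y * β , a≡ , b≡ ,
    trans (shift (+ d) (+ y) (+ ∣ b ∣) (+ x) (+ ∣ a ∣) (toℤ d y (∣ b ∣) x (∣ a ∣) eq))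
      (trans (cong₂ (λ s t → + x * s - + y * t) (proj₂ ∣ a ∣-multiple) (proj₂ ∣ b ∣-multiple))
        (id₁ (+ x) (+ y) α β a b))
    where
    id₁ : ∀ x y α β a b → x * (α * a) - y * (β * b) ≡ x * α * a + - y * β * b
    id₁ = solve-∀
  combination (Bézout.-+ x y eq) = - + x * α , + y * β , a≡ , b≡ ,
    trans (shift (+ d) (+ x) (+ ∣ a ∣) (+ y) (+ ∣ b ∣) (toℤ d x (∣ a ∣) y (∣ b ∣) eq))
      (trans (cong₂ (λ s t → + y * t - + x * s) (proj₂ ∣ a ∣-multiple) (proj₂ ∣ b ∣-multiple))
        (id₁ (+ x) (+ y) α β a b))
    where
    id₁ : ∀ x y α β a b → y * (β * b) - x * (α * a) ≡ - x * α * a + y * β * b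
    id₁ = solve-∀

-- Dividing a and b by their greatest common divisor g leaves a′ and b′ with x a′ + y b′ = 1. Any
-- two lattice points of the line then differ by a multiple of (b′, -a′), which serves as the step.
consecutive⇒segment : ∀ {r e} L → 3 ≤ r → AreConsecutiveOn r L e → ∃ (Segment e)
consecutive⇒segment {r} {e} L 3≤r (e⊆L , (xs , unique , refl , e⇔xs) , fill) =
  build (bézout a b)
  where
  open Line L
  build : (∃ λ g → ∃ λ a′ → ∃ λ b′ → ∃ λ x → ∃ λ y →
            a ≡ a′ * g × b ≡ b′ * g × g ≡ x * a + y * b) → ∃ (Segment e)
  build (g , a′ , b′ , x , y , a≡ , b≡ , g≡) = d , record
    { along  = λ {p} {q} → aligned {p} {q}
    ; convex = closed
    ; avoid  = third xs unique 3≤r (λ z → Equivalence.from (e⇔xs z))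
    }
    where
    d : ℤ²
    d = b′ , - a′
    g≢0 : g ≢ 0ℤ
    g≢0 refl = nondegenerate (trans a≡ (ℤ.*-zeroʳ a′) , trans b≡ (ℤ.*-zeroʳ b′))
    unit : x * a′ + y * b′ - 1ℤ ≡ 0ℤ
    unit = *-nonzero _ g≢0 (trans (id₁ x a′ y b′ g)
      (trans (cong₂ (λ s t → x * s + y * t - g) (sym a≡) (sym b≡)) (ℤ.i≡j⇒i-j≡0 (sym g≡))))
      where
      id₁ : ∀ x a′ y b′ g → (x * a′ + y * b′ - 1ℤ) * g ≡ x * (a′ * g) + y * (b′ * g) - g
      id₁ = solve-∀
    aligned : ∀ {p q} → p ∈ e → q ∈ e → ∃ λ k → q ≡ p ⊕ k ⊙ d
    aligned {p₁ , p₂} {q₁ , q₂} p∈e q∈e = k , cong₂ _,_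
      (trans (id₂ x a′ y b′ p₁ p₂ q₁ q₂)
        (trans (cong₂ (λ s t → p₁ + k * b′ + x * s - t * (q₁ - p₁)) orth unit) (id₄ _ x (q₁ - p₁))))
      (trans (id₃ x a′ y b′ p₁ p₂ q₁ q₂)
        (trans (cong₂ (λ s t → p₂ + k * - a′ + y * s - t * (q₂ - p₂)) orth unit) (id₄ _ y (q₂ - p₂))))
      where
      -- If q - p = k d, then y (q₁ - p₁) - x (q₂ - p₂) = k (x a′ + y b′) = k.
      k = y * (q₁ - p₁) - x * (q₂ - p₂)
      orth : a′ * (q₁ - p₁) + b′ * (q₂ - p₂) ≡ 0ℤ
      orth = *-nonzero _ g≢0 (trans (id₁ a′ b′ g p₁ p₂ q₁ q₂)
        (trans (cong₂ (λ s t → s * q₁ + t * q₂ - (s * p₁ + t * p₂)) (sym a≡) (sym b≡))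
          (ℤ.i≡j⇒i-j≡0 (trans (e⊆L q∈e) (sym (e⊆L p∈e))))))
        where
        id₁ : ∀ a′ b′ g p₁ p₂ q₁ q₂ → (a′ * (q₁ - p₁) + b′ * (q₂ - p₂)) * g ≡
              a′ * g * q₁ + b′ * g * q₂ - (a′ * g * p₁ + b′ * g * p₂)
        id₁ = solve-∀
      id₂ : ∀ x a′ y b′ p₁ p₂ q₁ q₂ → q₁ ≡ p₁ + (y * (q₁ - p₁) - x * (q₂ - p₂)) * b′
            + x * (a′ * (q₁ - p₁) + b′ * (q₂ - p₂)) - (x * a′ + y * b′ - 1ℤ) * (q₁ - p₁)
      id₂ = solve-∀
      id₃ : ∀ x a′ y b′ p₁ p₂ q₁ q₂ → q₂ ≡ p₂ + (y * (q₁ - p₁) - x * (q₂ - p₂)) * - a′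
            + y * (a′ * (q₁ - p₁) + b′ * (q₂ - p₂)) - (x * a′ + y * b′ - 1ℤ) * (q₂ - p₂)
      id₃ = solve-∀
      id₄ : ∀ s x z → s + x * 0ℤ - 0ℤ * z ≡ s
      id₄ = solve-∀
    on-line : ∀ {p} k → p ∈ e → p ⊕ k ⊙ d ∈ latticePoints L
    on-line {p₁ , p₂} k p∈e = trans
      (trans (cong₂ (λ s t → s * (p₁ + k * b′) + t * (p₂ + k * - a′)) a≡ b≡)
        (trans (id₁ a′ b′ g k p₁ p₂) (cong₂ (λ s t → s * p₁ + t * p₂) (sym a≡) (sym b≡))))
      (e⊆L p∈e)
      where
      id₁ : ∀ a′ b′ g k p₁ p₂ → a′ * g * (p₁ + k * b′) + b′ * g * (p₂ + k * - a′) ≡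
            a′ * g * p₁ + b′ * g * p₂
      id₁ = solve-∀
    closed : ∀ {p} m n → p ∈ e → p ⊕ (+ (m ℕ.+ n)) ⊙ d ∈ e → p ⊕ (+ m) ⊙ d ∈ e
    -- The case m = 0 is split off because `Between` needs a positive total weight. Otherwise the
    -- point is the mean of p with weight n and of the far end with weight m.
    closed {p} ℕ.zero n p∈e _ = subst (_∈ e) (sym (⊕-identity p d)) p∈e
    closed {p} (ℕ.suc m) n p∈e q∈e = fill p∈e q∈e (on-line (+ ℕ.suc m) p∈e)
      (n , ℕ.suc m , ℕ.<-≤-trans (ℕ.s≤s ℕ.z≤n) (ℕ.m≤n+m (ℕ.suc m) n) ,
       id₁ (+ n) (+ ℕ.suc m) _ _ , id₁ (+ n) (+ ℕ.suc m) _ _)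
      where
      id₁ : ∀ n m p d → (n + m) * (p + m * d) ≡ n * p + m * (p + (m + n) * d)
      id₁ = solve-∀
    third : ∀ xs → Unique xs → 3 ≤ length xs → (∀ z → z ∈ₗ xs → z ∈ e) →
            ∀ p q → ∃ λ s → s ∈ e × s ≢ p × s ≢ q
    third (z₁ ∷ z₂ ∷ z₃ ∷ zs) ((z₁≢z₂ ∷ z₁≢z₃ ∷ _) ∷ (z₂≢z₃ ∷ _) ∷ _) _ ∈e p q
      with z₁ ≟ p | z₁ ≟ q | z₂ ≟ p | z₂ ≟ q
    -- If neither z₁ nor z₂ avoids both p and q, they are p and q in some order, and z₃ avoids both.
    ... | no z₁≢p | no z₁≢q | _ | _ = z₁ , ∈e z₁ (here refl) , z₁≢p , z₁≢q
    ... | _ | _ | no z₂≢p | no z₂≢q = z₂ , ∈e z₂ (there (here refl)) , z₂≢p , z₂≢q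
    ... | yes refl | _ | yes eq | _ = ⊥-elim (z₁≢z₂ (sym eq))
    ... | yes refl | _ | no _ | yes refl =
      z₃ , ∈e z₃ (there (there (here refl))) , (λ eq → z₁≢z₃ (sym eq)) , (λ eq → z₂≢z₃ (sym eq))
    ... | no _ | yes refl | _ | yes eq = ⊥-elim (z₁≢z₂ (sym eq))
    ... | no _ | yes refl | yes refl | no _ =
      z₃ , ∈e z₃ (there (there (here refl))) , (λ eq → z₂≢z₃ (sym eq)) , (λ eq → z₁≢z₃ (sym eq))
    third (_ ∷ _ ∷ []) _ (ℕ.s≤s (ℕ.s≤s ()))
    third (_ ∷ []) _ (ℕ.s≤s ())

-- Eliminating t gives s (i j − 1) = i − 1 with i = n + 2, hence |i j − 1| ≤ i − 1.
common-point-coefficient : ∀ n s t j → j ≢ 0ℤ →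
  t * + ℕ.suc (ℕ.suc n) + s - 1ℤ ≡ 0ℤ → 1ℤ - t - s * j ≡ 0ℤ → j ≡ 1ℤ
common-point-coefficient n s t j j≢0 eq₁ eq₂ = bound j j≢0 (∣⇒≤ (divides-ℕ ∣ s ∣ product))
  where
  i = + ℕ.suc (ℕ.suc n)
  id₁ : ∀ i s t j → i - 1ℤ ≡ s * (i * j - 1ℤ) + (t * i + s - 1ℤ) + i * (1ℤ - t - s * j)
  id₁ = solve-∀
  id₂ : ∀ x i → x + 0ℤ + i * 0ℤ ≡ x
  id₂ = solve-∀
  product : ℕ.suc n ≡ ∣ s ∣ ℕ.* ∣ i * j - 1ℤ ∣
  product = trans (cong ∣_∣ (trans (id₁ i s t j)
    (trans (cong₂ (λ x y → s * (i * j - 1ℤ) + x + i * y) eq₁ eq₂) (id₂ (s * (i * j - 1ℤ)) i))))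
    (ℤ.abs-* s (i * j - 1ℤ))
  bound : ∀ j → j ≢ 0ℤ → ∣ i * j - 1ℤ ∣ ≤ ℕ.suc n → j ≡ 1ℤ
  bound (+ 0) j≢0 _ = ⊥-elim (j≢0 refl)
  bound (+ 1) _ _ = refl
  bound (+ ℕ.suc (ℕ.suc m)) _ le = ⊥-elim (ℕ.<⇒≱ (ℕ.s≤s
    (ℕ.≤-trans (ℕ.m≤m*n (ℕ.suc n) (ℕ.suc (ℕ.suc m))) (ℕ.m≤n+m _ m))) le)
  bound -[1+ m ] _ le = ⊥-elim (ℕ.<⇒≱ (ℕ.s≤s (ℕ.s≤s
    (ℕ.≤-trans (ℕ.≤-trans (ℕ.n≤1+n n) (ℕ.m≤m*n (ℕ.suc n) (ℕ.suc m)))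
      (ℕ.≤-trans (ℕ.m≤n+m _ m) (ℕ.m≤m+n _ 0))))) le)

∣det∣-swap : ∀ u v → ∣ det v u ∣ ≡ ∣ det u v ∣
∣det∣-swap u v = trans (cong ∣_∣ (id₁ (proj₁ u) (proj₂ u) (proj₁ v) (proj₂ v))) (ℤ.∣-i∣≡∣i∣ (det u v))
  where
  id₁ : ∀ u₁ u₂ v₁ v₂ → v₁ * u₂ - v₂ * u₁ ≡ - (u₁ * v₂ - u₂ * v₁)
  id₁ = solve-∀

∣det∣-⊝ˡ : ∀ u v → ∣ det (⊝ u) v ∣ ≡ ∣ det u v ∣
∣det∣-⊝ˡ u v = trans (cong ∣_∣ (id₁ (proj₁ u) (proj₂ u) (proj₁ v) (proj₂ v))) (ℤ.∣-i∣≡∣i∣ (det u v))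
  where
  id₁ : ∀ u₁ u₂ v₁ v₂ → - u₁ * v₂ - - u₂ * v₁ ≡ - (u₁ * v₂ - u₂ * v₁)
  id₁ = solve-∀

-- Crossings when every point of an edge lies on a second edge.

module CoveredTwice
  (em : ExcludedMiddle (suc 0ℓ))
  (E : Pred (Pred ℤ² 0ℓ) (suc 0ℓ))
  (segment : ∀ {e} → e ∈ E → ∃ (Segment e))
  (meet : ∀ {e f} → e ∈ E → f ∈ E → e ≬ f)
  (line-unique : ∀ L {e f} → e ∈ E → f ∈ E → e ⊆ latticePoints L → f ⊆ latticePoints L → e ≐ f)
  (other : ∀ {e p} → e ∈ E → p ∈ e → ∃ λ f → f ∈ E × p ∈ f × ¬ f ≐ e)
  where

  -- The edges share a point c, so parallel steps put both on the line through c with normal (-u₂,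
  -- u₁), and a line carries only one edge.
  parallel⇒≐ : ∀ {e u f v} → e ∈ E → f ∈ E → Segment e u → Segment f v → det u v ≡ 0ℤ → e ≐ f
  parallel⇒≐ {e} {u₁ , u₂} {f} {v₁ , v₂} e∈E f∈E eS fS D≡0 with meet e∈E f∈E
  ... | (c₁ , c₂) , c∈e , c∈f = line-unique L e∈E f∈E e⊆L f⊆L
    where
    L : Line
    L = record
      { a = - u₂ ; b = u₁ ; c = - u₂ * c₁ + u₁ * c₂
      ; nondegenerate = λ (-u₂≡0 , u₁≡0) → step-nonzero eS (cong₂ _,_ u₁≡0
          (trans (sym (ℤ.neg-involutive u₂)) (cong -_ -u₂≡0)))
      }
    e⊆L : e ⊆ latticePoints L
    e⊆L q∈e with along eS c∈e q∈e
    ... | k , refl = id₁ c₁ c₂ u₁ u₂ k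
      where
      id₁ : ∀ c₁ c₂ u₁ u₂ k → - u₂ * (c₁ + k * u₁) + u₁ * (c₂ + k * u₂) ≡ - u₂ * c₁ + u₁ * c₂
      id₁ = solve-∀
    f⊆L : f ⊆ latticePoints L
    f⊆L q∈f with along fS c∈f q∈f
    ... | k , refl = trans (id₁ c₁ c₂ u₁ u₂ v₁ v₂ k)
      (trans (cong (λ z → - u₂ * c₁ + u₁ * c₂ + k * z) D≡0) (id₂ _ k))
      where
      id₁ : ∀ c₁ c₂ u₁ u₂ v₁ v₂ k → - u₂ * (c₁ + k * v₁) + u₁ * (c₂ + k * v₂) ≡
            - u₂ * c₁ + u₁ * c₂ + k * (u₁ * v₂ - u₂ * v₁)
      id₁ = solve-∀
      id₂ : ∀ z k → z + k * 0ℤ ≡ z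
      id₂ = solve-∀

  intersection-unique : ∀ {e f p q} → e ∈ E → f ∈ E → ¬ e ≐ f →
                        p ∈ e → p ∈ f → q ∈ e → q ∈ f → q ≡ p
  intersection-unique {p = p} {q} e∈E f∈E e≢f p∈e p∈f q∈e q∈f
    with segment e∈E | segment f∈E
  ... | u , eS | v , fS with along eS p∈e q∈e | along fS p∈f q∈f
  ... | k , q≡₁ | l , q≡₂ =
    trans q≡₁ (trans (cong (λ z → p ⊕ z ⊙ u) k≡0) (⊕-identity p u))
    where
    id₁ : ∀ k l p u v → k * u + - l * v ≡ p + k * u + - (p + l * v)
    id₁ = solve-∀
    k≡0 : k ≡ 0ℤ
    k≡0 = proj₁ (independent (λ D≡0 → e≢f (parallel⇒≐ e∈E f∈E eS fS D≡0)) k (- l)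
      (trans (componentwise₃ (id₁ k l) p u v)
        (trans (cong₂ (λ a b → a ⊕ ⊝ b) (sym q≡₁) (sym q≡₂))
          (⊕-inverse q))))

  -- Pairs of edges with least determinant.

  -- The competitors are all pairs of distinct edges, not only those at one point. Taking absolute
  -- values leaves the order of the edges and the signs of the steps free, so `swap` and `reverse`
  -- can bring a configuration into standard position.
  record Minimal (e : Pred ℤ² 0ℓ) (u : ℤ²) (f : Pred ℤ² 0ℓ) (v : ℤ²) : Set₁ where
    field
      e∈E : e ∈ E
      f∈E : f ∈ E
      eS  : Segment e u
      fS  : Segment f v
      e≢f : ¬ e ≐ f
      minimum : ∀ {g x h y} → g ∈ E → h ∈ E → Segment g x → Segment h y → ¬ g ≐ h →
                ∣ det u v ∣ ≤ ∣ det x y ∣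

    det≢0 : det u v ≢ 0ℤ
    det≢0 D≡0 = e≢f (parallel⇒≐ e∈E f∈E eS fS D≡0)

    off : ∀ {p} → p ∈ e → p ∈ f → p ⊕ v ∈ f → p ⊕ v ∉ e
    off {p} p∈e p∈f q∈f q∈e = step-nonzero fS
      (⊕-fixed p v (intersection-unique e∈E f∈E e≢f p∈e p∈f q∈e q∈f))

  open Minimal

  swap : ∀ {e u f v} → Minimal e u f v → Minimal f v e u
  swap {u = u} {v = v} M = record
    { e∈E = f∈E M ; f∈E = e∈E M ; eS = fS M ; fS = eS M
    ; e≢f = λ (f⊆e , e⊆f) → e≢f M (e⊆f , f⊆e)
    ; minimum = λ g∈E h∈E gS hS g≢h →
        subst (_≤ _) (sym (∣det∣-swap u v)) (minimum M g∈E h∈E gS hS g≢h)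
    }

  reverse : ∀ {e u f v} → Minimal e u f v → Minimal e (⊝ u) f v
  reverse {u = u} {v = v} M = record
    { e∈E = e∈E M ; f∈E = f∈E M ; eS = Segment-⊝ (eS M) ; fS = fS M ; e≢f = e≢f M
    ; minimum = λ g∈E h∈E gS hS g≢h →
        subst (_≤ _) (sym (∣det∣-⊝ˡ u v)) (minimum M g∈E h∈E gS hS g≢h)
    }

  -- If g meets e after |k| of its own steps w, then |k| |det u w| = |det u v|,
  -- so minimality forces |k| = 1.
  transversal : ∀ {e u f v g p} → Minimal e u f v → p ∈ e → p ∈ f → p ⊕ v ∈ f →
    g ∈ E → ¬ g ≐ f → p ⊕ v ∈ g →
    ∃ λ i → i ≢ 0ℤ × p ⊕ i ⊙ u ∈ e × p ⊕ i ⊙ u ∈ g × Segment g (i ⊙ u ⊕ ⊝ v)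
  transversal {e} {u} {f} {v} {g} {p} M p∈e p∈f q∈f g∈E g≢f q∈g
    with meet (e∈E M) g∈E | segment g∈E
  ... | x , x∈e , x∈g | w , gS with along (eS M) p∈e x∈e | along gS q∈g x∈g
  ... | i , refl | k , eq =
    i , i≢0 , x∈e , x∈g , subst (Segment g) (sym step≡) (unit-multiple k ∣k∣≡1)
    where
    step≡ : i ⊙ u ⊕ ⊝ v ≡ k ⊙ w
    step≡ = trans (componentwise₃ (id₁ i) p u v)
      (trans (cong (λ z → z ⊕ ⊝ p ⊕ ⊝ v) eq) (componentwise₃ (id₂ k) p v w))
      where
      id₁ : ∀ i p u v → i * u + - v ≡ p + i * u + - p + - v
      id₁ = solve-∀
      id₂ : ∀ k p v w → p + v + k * w + - p + - v ≡ k * w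
      id₂ = solve-∀
    det≡ : det u v ≡ - (k * det u w)
    det≡ = trans (id₁ i (proj₁ u) (proj₂ u) (proj₁ v) (proj₂ v))
      (trans (cong (λ z → - det u z) step≡)
        (id₂ k (proj₁ u) (proj₂ u) (proj₁ w) (proj₂ w)))
      where
      id₁ : ∀ i u₁ u₂ v₁ v₂ → u₁ * v₂ - u₂ * v₁ ≡ - (u₁ * (i * u₂ + - v₂) - u₂ * (i * u₁ + - v₁))
      id₁ = solve-∀
      id₂ : ∀ k u₁ u₂ w₁ w₂ → - (u₁ * (k * w₂) - u₂ * (k * w₁)) ≡ - (k * (u₁ * w₂ - u₂ * w₁))
      id₂ = solve-∀
    ∣det∣≡ : ∣ det u v ∣ ≡ ∣ k ∣ ℕ.* ∣ det u w ∣
    ∣det∣≡ = trans (cong ∣_∣ det≡) (trans (ℤ.∣-i∣≡∣i∣ (k * det u w)) (ℤ.abs-* k (det u w)))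
    e≢g : ¬ e ≐ g
    e≢g (_ , g⊆e) = off M p∈e p∈f q∈f (g⊆e q∈g)
    ∣k∣≡1 : ∣ k ∣ ≡ 1
    ∣k∣≡1 = factor ∣ k ∣ ∣ det u w ∣
      (λ eq → det≢0 M (ℤ.∣i∣≡0⇒i≡0 (trans ∣det∣≡ eq)))
      (subst (_≤ ∣ det u w ∣) ∣det∣≡ (minimum M (e∈E M) g∈E (eS M) gS e≢g))
      where
      factor : ∀ m n → m ℕ.* n ≢ 0 → m ℕ.* n ≤ n → m ≡ 1
      factor ℕ.zero n ≢0 _ = ⊥-elim (≢0 refl)
      factor 1 n _ _ = refl
      factor m@(ℕ.suc (ℕ.suc _)) ℕ.zero ≢0 _ = ⊥-elim (≢0 (ℕ.*-zeroʳ m))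
      factor (ℕ.suc (ℕ.suc m)) n@(ℕ.suc _) _ le =
        ⊥-elim (ℕ.m+1+n≰m n le)
    unit-multiple : ∀ k → ∣ k ∣ ≡ 1 → Segment g (k ⊙ w)
    unit-multiple (+ 1) refl = subst (Segment g) (sym (⊙-identity w)) gS
    unit-multiple -[1+ 0 ] refl = subst (Segment g)
      (cong₂ _,_ (sym (ℤ.-1*i≡-i (proj₁ w))) (sym (ℤ.-1*i≡-i (proj₂ w)))) (Segment-⊝ gS)
    i≢0 : i ≢ 0ℤ
    i≢0 refl = step-nonzero (fS M)
      (⊕-fixed p v (intersection-unique g∈E (f∈E M) g≢f p∈g p∈f q∈g q∈f))
      where
      p∈g : p ∈ g
      p∈g = subst (_∈ g) (⊕-identity p u) x∈g

  -- Triangles of single steps.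

  -- The third side h of the triangle with corners p, `p ⊕ u`, `p ⊕ v`; the last field makes these
  -- ends neighbours on h.
  record Joins (h : Pred ℤ² 0ℓ) (p u v : ℤ²) : Set₁ where
    constructor joins
    field
      h∈E   : h ∈ E
      start : p ⊕ u ∈ h
      end   : p ⊕ v ∈ h
      hS    : Segment h (v ⊕ ⊝ u)

  Link : ℤ² → ℤ² → ℤ² → Set₁
  Link p u v = ∃ λ h → Joins h p u v

  Joins-sym : ∀ {h p u v} → Joins h p u v → Joins h p v u
  Joins-sym {h} {u = u} {v} (joins h∈E u∈h v∈h hS) =
    joins h∈E v∈h u∈h (subst (Segment h) (componentwise₂ id₁ u v) (Segment-⊝ hS))
    where
    id₁ : ∀ u v → - (v + - u) ≡ u + - v
    id₁ = solve-∀

  Link-sym : ∀ {p u v} → Link p u v → Link p v u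
  Link-sym (h , J) = h , Joins-sym J

  -- If g meets e at `p ⊕ u`, then g is the third side. Otherwise `p ⊕ u` lies strictly between p
  -- and that meeting point, and `transversal` with e and f exchanged sends another edge h from
  -- there to `p ⊕ j ⊙ v` in a single step. The common point of g and h forces j = 1, so h is the
  -- third side.
  link⁺ : ∀ {e u f v g p} n → Minimal e u f v → p ∈ e → p ∈ f → p ⊕ v ∈ f →
          g ∈ E → p ⊕ v ∈ g → p ⊕ (+ ℕ.suc n) ⊙ u ∈ e → p ⊕ (+ ℕ.suc n) ⊙ u ∈ g →
          Segment g ((+ ℕ.suc n) ⊙ u ⊕ ⊝ v) → p ⊕ u ∈ e × Link p u v
  link⁺ {e} {u} {f} {v} {g} {p} ℕ.zero M p∈e p∈f q∈f g∈E q∈g x∈e x∈g gS =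
    subst (λ z → p ⊕ z ∈ e) (⊙-identity u) x∈e ,
    Link-sym (g , joins g∈E q∈g (subst (λ z → p ⊕ z ∈ g) (⊙-identity u) x∈g)
      (subst (λ z → Segment g (z ⊕ ⊝ v)) (⊙-identity u) gS))
  link⁺ {e} {u} {f} {v} {g} {p} (ℕ.suc n) M p∈e p∈f q∈f g∈E q∈g x∈e x∈g gS
    with convex-first (eS M) (ℕ.suc n) p∈e x∈e
  ... | r∈e with other (e∈E M) r∈e
  ... | h , h∈E , r∈h , h≢e with transversal (swap M) p∈f p∈e r∈e h∈E h≢e r∈h
  ... | j , j≢0 , _ , y∈h , hS with meet g∈E h∈E
  ... | z , z∈g , z∈h with along gS q∈g z∈g | along hS r∈h z∈h
  ... | t , z≡₁ | s , z≡₂ = r∈e , h , joins h∈E r∈h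
    (subst (λ w → p ⊕ w ∈ h) j⊙v≡v y∈h) (subst (λ w → Segment h (w ⊕ ⊝ u)) j⊙v≡v hS)
    where
    i = + ℕ.suc (ℕ.suc n)
    id₁ : ∀ i j s t p u v → (t * i + s - 1ℤ) * u + (1ℤ - t - s * j) * v ≡
          p + v + t * (i * u + - v) + - (p + u + s * (j * v + - u))
    id₁ = solve-∀
    coefficients : t * i + s - 1ℤ ≡ 0ℤ × 1ℤ - t - s * j ≡ 0ℤ
    coefficients = independent (det≢0 M) _ _ (trans (componentwise₃ (id₁ i j s t) p u v)
      (trans (cong₂ (λ a b → a ⊕ ⊝ b) (sym z≡₁) (sym z≡₂)) (⊕-inverse z)))
    j⊙v≡v : j ⊙ v ≡ v
    j⊙v≡v = trans (cong (_⊙ v)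
      (common-point-coefficient n s t j j≢0 (proj₁ coefficients) (proj₂ coefficients))) (⊙-identity v)

  -- A second edge through `p ⊕ v` meets e at `p ⊕ i ⊙ u`; the sign of i decides on which side of p
  -- the triangle lies.
  link : ∀ {e u f v p} → Minimal e u f v → p ∈ e → p ∈ f → p ⊕ v ∈ f →
         (p ⊕ u ∈ e × Link p u v) ⊎ (p ⊕ ⊝ u ∈ e × Link p (⊝ u) v)
  link {e} {u} {f} {v} {p} M p∈e p∈f q∈f with other (f∈E M) q∈f
  ... | g , g∈E , q∈g , g≢f with transversal M p∈e p∈f q∈f g∈E g≢f q∈g
  ... | + 0 , i≢0 , _ = ⊥-elim (i≢0 refl)
  ... | + ℕ.suc n , _ , x∈e , x∈g , gS = inj₁ (link⁺ n M p∈e p∈f q∈f g∈E q∈g x∈e x∈g gS)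
  ... | -[1+ n ] , _ , x∈e , x∈g , gS =
    inj₂ (link⁺ n (reverse M) p∈e p∈f q∈f g∈E q∈g
      (subst (λ w → p ⊕ w ∈ e) flip x∈e) (subst (λ w → p ⊕ w ∈ g) flip x∈g)
      (subst (λ w → Segment g (w ⊕ ⊝ v)) flip gS))
    where
    id₁ : ∀ k u → - k * u ≡ k * - u
    id₁ = solve-∀
    flip : -[1+ n ] ⊙ u ≡ (+ ℕ.suc n) ⊙ ⊝ u
    flip = componentwise₂ (λ u _ → id₁ (+ ℕ.suc n) u) u 𝟘

  -- Exclusion of triangles.

  -- The third sides have opposite steps, hence coincide as edges. Then 2u would be a multiple of v
  -- - u, against independence of u and v.
  no-opposite-links : ∀ {p u v} → det u v ≢ 0ℤ → Link p u v → Link p (⊝ u) (⊝ v) → ⊥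
  no-opposite-links {p} {u} {v} D≢0 (h , joins h∈E u∈h _ hS) (h′ , joins h′∈E -u∈h′ _ h′S)
    with along hS u∈h (proj₂ (parallel⇒≐ h∈E h′∈E hS h′S parallel) -u∈h′)
    where
    id₁ : ∀ u₁ u₂ v₁ v₂ → (v₁ + - u₁) * (- v₂ + - - u₂) - (v₂ + - u₂) * (- v₁ + - - u₁) ≡ 0ℤ
    id₁ = solve-∀
    parallel : det (v ⊕ ⊝ u) (⊝ v ⊕ ⊝ ⊝ u) ≡ 0ℤ
    parallel = id₁ (proj₁ u) (proj₂ u) (proj₁ v) (proj₂ v)
  ... | k , eq = absurd k (proj₂ coefficients) (proj₁ coefficients)
    where
    id₁ : ∀ k p u v → (k - + 2) * u + - k * v ≡ p + - u + - (p + u + k * (v + - u))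
    id₁ = solve-∀
    coefficients : k - + 2 ≡ 0ℤ × - k ≡ 0ℤ
    coefficients = independent D≢0 _ _ (trans (componentwise₃ (id₁ k) p u v)
      (trans (cong (λ z → p ⊕ ⊝ u ⊕ ⊝ z) (sym eq)) (⊕-inverse (p ⊕ ⊝ u))))
    absurd : ∀ k → - k ≡ 0ℤ → k - + 2 ≡ 0ℤ → ⊥
    absurd (+ 0) _ ()
    absurd (+ ℕ.suc _) () _
    absurd -[1+ _ ] () _

  -- `link` builds triangles at p on -u and on -v. Either one of them is the triangle on -u, -v,
  -- opposite to the given one, or they are the triangles on -u, v and on u, -v, opposite to each
  -- other.
  one-sided : ∀ {e u f v p} → Minimal e u f v → p ∈ e → p ∈ f → Link p u v →
              p ⊕ ⊝ u ∈ e → p ⊕ ⊝ v ∈ f → ⊥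
  one-sided {u = u} {v = v} {p = p} M p∈e p∈f uv -u∈e -v∈f
    with link (swap (reverse M)) p∈f p∈e -u∈e | link (swap (reverse (swap M))) p∈e p∈f -v∈f
  ... | inj₂ (_ , -v-u) | _ = no-opposite-links (det≢0 M) uv (Link-sym -v-u)
  ... | _ | inj₂ (_ , -u-v) = no-opposite-links (det≢0 M) uv -u-v
  ... | inj₁ (_ , v-u) | inj₁ (_ , u-v) =
    no-opposite-links (det≢0 (reverse M)) (Link-sym v-u)
      (subst (λ w → Link p w (⊝ v)) (sym (⊝-involutive u)) u-v)

  -- Subtracting u from v does not change the determinant with u, so minimality passes to the pair
  -- at the corner `p ⊕ u`.
  corner : ∀ {e u f v g p} → Minimal e u f v → p ∈ e → p ∈ f → p ⊕ v ∈ f → Joins g p u v →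
           Minimal e u g (v ⊕ ⊝ u)
  corner {u = u} {v = v} M p∈e p∈f v∈f (joins g∈E _ v∈g gS) = record
    { e∈E = e∈E M ; f∈E = g∈E ; eS = eS M ; fS = gS
    ; e≢f = λ (_ , g⊆e) → off M p∈e p∈f v∈f (g⊆e v∈g)
    ; minimum = λ x∈E y∈E xS yS x≢y → subst (_≤ _)
        (cong ∣_∣ (id₁ (proj₁ u) (proj₂ u) (proj₁ v) (proj₂ v))) (minimum M x∈E y∈E xS yS x≢y)
    }
    where
    id₁ : ∀ u₁ u₂ v₁ v₂ → u₁ * v₂ - u₂ * v₁ ≡ u₁ * (v₂ + - u₂) - u₂ * (v₁ + - u₁)
    id₁ = solve-∀

  -- This is `one-sided` at `p ⊕ u`, where the sides leave along -u and v - u and f is the third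
  -- side.
  one-sided-corner : ∀ {e u f v g p} → Minimal e u f v → p ∈ e → p ∈ f → p ⊕ u ∈ e → p ⊕ v ∈ f →
                     Joins g p u v → p ⊕ u ⊕ u ∈ e → p ⊕ u ⊕ ⊝ (v ⊕ ⊝ u) ∈ g → ⊥
  one-sided-corner {e} {u} {f} {v} {g} {p} M p∈e p∈f u∈e v∈f J 2u∈e =
    one-sided (reverse (corner M p∈e p∈f v∈f J)) u∈e (Joins.start J)
      (f , joins (f∈E M) (subst (_∈ f) (sym (⊕-⊝-cancel p u)) p∈f)
        (subst (_∈ f) (componentwise₃ id₁ p u v) v∈f)
        (subst (Segment f) (componentwise₂ id₂ u v) (fS M)))
      (subst (λ w → p ⊕ u ⊕ w ∈ e) (sym (⊝-involutive u)) 2u∈e)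
    where
    id₁ : ∀ p u v → p + v ≡ p + u + (v + - u)
    id₁ = solve-∀
    id₂ : ∀ u v → v ≡ v + - u + - - u
    id₂ = solve-∀

  -- The two non-memberships leave `link` one choice each: an edge h with step 2u - v through
  -- `p ⊕ v` and p + 2u, and an edge h′ with step -u - v through `p ⊕ u` and p - v. Their common
  -- point would lie k steps along h with 3k = -1.
  no-pinwheel : ∀ {e u f v g p} → Minimal e u f v → p ∈ e → p ∈ f → p ⊕ u ∈ e → p ⊕ v ∈ f →
                Joins g p u v → p ⊕ u ⊕ u ∈ e → p ⊕ u ⊕ ⊝ (v ⊕ ⊝ u) ∉ g →
                p ⊕ ⊝ v ∈ f → p ⊕ ⊝ u ∉ e → ⊥
  no-pinwheel {u = u} {v = v} {p = p} M p∈e p∈f u∈e v∈f J 2u∈e ∉g -v∈f ∉e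
    with link (swap (corner M p∈e p∈f v∈f J)) (Joins.start J) u∈e 2u∈e
       | link (swap (reverse (swap M))) p∈e p∈f -v∈f
  ... | inj₂ (∈g , _) | _ = ∉g ∈g
  ... | _ | inj₂ (∈e , _) = ∉e ∈e
  ... | inj₁ (_ , h , joins h∈E _ 2u∈h hS) | inj₁ (_ , h′ , joins h′∈E u∈h′ _ h′S)
    with meet h∈E h′∈E
  ... | z , z∈h , z∈h′ with along hS 2u∈h z∈h | along h′S u∈h′ z∈h′
  ... | k , z≡₁ | l , z≡₂ = indivisible ∣ k ∣ (trans (sym (ℤ.abs-* k (+ 3)))
      (cong ∣_∣ (trans (id₂ k l) (cong₂ (λ a b → a - b - 1ℤ) (proj₁ coefficients) (proj₂ coefficients)))))
    where
    id₁ : ∀ k l p u v → (1ℤ + + 2 * k + l) * u + (l - k) * v ≡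
          p + u + u + k * (u + - (v + - u)) + - (p + u + l * (- v + - u))
    id₁ = solve-∀
    id₂ : ∀ k l → k * + 3 ≡ 1ℤ + + 2 * k + l - (l - k) - 1ℤ
    id₂ = solve-∀
    coefficients : 1ℤ + + 2 * k + l ≡ 0ℤ × l - k ≡ 0ℤ
    coefficients = independent (det≢0 M) _ _ (trans (componentwise₃ (id₁ k l) p u v)
      (trans (cong₂ (λ a b → a ⊕ ⊝ b) (sym z≡₁) (sym z≡₂)) (⊕-inverse z)))
    indivisible : ∀ m → m ℕ.* 3 ≡ 1 → ⊥
    indivisible ℕ.zero ()
    indivisible (ℕ.suc _) ()

  -- Each side has a third point beyond one of its ends. Two sides continuing past the same corner
  -- contradict `one-sided` or `one-sided-corner`; what remains is a pinwheel in one of two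
  -- orientations, related by `swap`.
  no-triangle : ∀ {e u f v p} → Minimal e u f v → p ∈ e → p ∈ f → p ⊕ u ∈ e → p ⊕ v ∈ f →
                Link p u v → ⊥
  no-triangle {e} {u} {f} {v} {p} M p∈e p∈f u∈e v∈f (g , J@(joins _ u∈g v∈g gS))
    with extend (eS M) p∈e u∈e | extend (fS M) p∈f v∈f
       | extend gS u∈g (subst (_∈ g) (componentwise₃ id₁ p u v) v∈g)
    where
    id₁ : ∀ p u v → p + v ≡ p + u + (v + - u)
    id₁ = solve-∀
  ... | inj₁ -u∈e | inj₁ -v∈f | _ = one-sided M p∈e p∈f (g , J) -u∈e -v∈f
  ... | inj₁ -u∈e | inj₂ 2v∈f | _ =
    no-pinwheel (swap M) p∈f p∈e v∈f u∈e (Joins-sym J) 2v∈f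
      (one-sided-corner (swap M) p∈f p∈e v∈f u∈e (Joins-sym J) 2v∈f) -u∈e
      (one-sided M p∈e p∈f (g , J) -u∈e)
  ... | inj₂ 2u∈e | _ | inj₁ ∈g = one-sided-corner M p∈e p∈f u∈e v∈f J 2u∈e ∈g
  ... | inj₂ 2u∈e | inj₂ 2v∈f | inj₂ ∈g =
    one-sided-corner (swap M) p∈f p∈e v∈f u∈e (Joins-sym J) 2v∈f
      (subst (_∈ g) (componentwise₃ id₁ p u v) ∈g)
    where
    id₁ : ∀ p u v → p + u + (v + - u) + (v + - u) ≡ p + v + - (u + - v)
    id₁ = solve-∀
  ... | inj₂ 2u∈e | inj₁ -v∈f | inj₂ _ =
    no-pinwheel M p∈e p∈f u∈e v∈f J 2u∈e
      (one-sided-corner M p∈e p∈f u∈e v∈f J 2u∈e) -v∈f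
      (λ -u∈e → one-sided M p∈e p∈f (g , J) -u∈e -v∈f)

  -- At the common point f continues in direction v or -v, and `link` then finds a triangle; signs
  -- are adjusted by `reverse`.
  no-minimal : ∀ {e u f v} → Minimal e u f v → ⊥
  no-minimal {e} {f = f} M with meet (e∈E M) (f∈E M)
  ... | p , p∈e , p∈f = [ from M , from (swap (reverse (swap M))) ]′ (neighbour (fS M) p∈f)
    where
    from : ∀ {u v} → Minimal e u f v → p ⊕ v ∈ f → ⊥
    from M v∈f with link M p∈e p∈f v∈f
    ... | inj₁ (u∈e , L) = no-triangle M p∈e p∈f u∈e v∈f L
    ... | inj₂ (u∈e , L) = no-triangle (reverse M) p∈e p∈f u∈e v∈f L

  -- A second edge through a point of e yields a pair of distinct edges, so the absolute
  -- determinants of such pairs attain a least value.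
  no-edge : ∀ {e} → e ∈ E → ⊥
  no-edge {e} e∈E with segment e∈E
  ... | u , eS with avoid eS 𝟘 𝟘
  ... | p , p∈e , _ with other e∈E p∈e
  ... | f , f∈E , _ , f≢e with segment f∈E
  ... | v , fS with least em Crossing (_ , e , f , u , v , (e∈E , f∈E , eS , fS , distinct) , refl)
    where
    Crossing : ℕ → Set₁
    Crossing n = ∃ λ e → ∃ λ f → ∃ λ u → ∃ λ v →
      (e ∈ E × f ∈ E × Segment e u × Segment f v × ¬ e ≐ f) × ∣ det u v ∣ ≡ n
    distinct : ¬ e ≐ f
    distinct (e⊆f , f⊆e) = f≢e (f⊆e , e⊆f)
  ... | _ , (_ , _ , _ , _ , (d∈E , g∈E , dS , gS , d≢g) , refl) , ≤-all = no-minimal record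
    { e∈E = d∈E ; f∈E = g∈E ; eS = dS ; fS = gS ; e≢f = d≢g
    ; minimum = λ h∈E k∈E hS kS h≢k → ≤-all _ (_ , _ , _ , _ , (h∈E , k∈E , hS , kS , h≢k) , refl)
    }

-- From the intersecting hypothesis to the isolated vertex and the cover.

module _ (em : ExcludedMiddle (suc 0ℓ)) where

  em₀ : ExcludedMiddle 0ℓ
  em₀ = map′ lower (lift {ℓ = suc 0ℓ}) em

  by-contradiction : ∀ {P : Set₁} → ¬ ¬ P → P
  by-contradiction = decidable-stable em

  module _ {X : Set} {H : Hypergraph X} where
    open Hypergraph H

    -- Two disjoint edges would form a matching of size 2; nonemptiness is what makes them distinct.
    intersecting⇒meet : Intersecting H → (∀ {e} → e ∈ E → ∃ (_∈ e)) →
                        ∀ {e f} → e ∈ E → f ∈ E → e ≬ f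
    intersecting⇒meet (_ , ≤1) nonempty {e} {f} e∈E f∈E = decidable-stable em₀ λ disjoint →
      ℕ.<⇒≱ (ℕ.s≤s (ℕ.s≤s ℕ.z≤n)) (≤1 (e ∷ f ∷ [])
        ( e∈E ∷ f∈E ∷ []
        , (((λ (e⊆f , _) → let x , x∈e = nonempty e∈E in disjoint (x , x∈e , e⊆f x∈e))
          , λ (x∈e , x∈f) → disjoint (_ , x∈e , x∈f)) ∷ []) ∷ [] ∷ []))

    intersecting⇒edge : Intersecting H → ∃ (_∈ E)
    intersecting⇒edge ((e ∷ _ , (e∈E ∷ _ , _) , _) , _) = e , e∈E

    no-isolated⇒other : ¬ (∃ λ v → IsIsolated H v) → ∀ {e v} → e ∈ E → v ∈ e →
                        ∃ λ f → f ∈ E × v ∈ f × ¬ f ≐ e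
    no-isolated⇒other none e∈E v∈e = by-contradiction λ alone →
      none (_ , E⊆2^V e∈E v∈e , _ , e∈E , v∈e ,
        λ f∈E v∈f → decidable-stable em₀ λ f≢e → alone (_ , f∈E , v∈f , f≢e))

theorem3p3 : ExcludedMiddle (suc 0ℓ) →
    (r : ℕ) → 3 ≤ r →
    (H : Hypergraph ℤ²) → IsSegmentHypergraph r H → Intersecting H →
    (∃ λ v → IsIsolated H v) × (∃ λ t → IsCoveringNumber H t × t ≤ r ∸ 1)
theorem3p3 em r 3≤r H SH intersecting = isolated , covering isolated
  where
  open Hypergraph H
  open IsSegmentHypergraph SH

  segment : ∀ {e} → e ∈ E → ∃ (Segment e)
  segment e∈E = let L , on-L = edge-consecutive e∈E in consecutive⇒segment L 3≤r on-L

  meet : ∀ {e f} → e ∈ E → f ∈ E → e ≬ f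
  meet = intersecting⇒meet em {H = H} intersecting λ e∈E →
    let p , p∈e , _ = avoid (proj₂ (segment e∈E)) 𝟘 𝟘 in p , p∈e

  isolated : ∃ λ v → IsIsolated H v
  isolated = by-contradiction em λ none →
    CoveredTwice.no-edge em E segment meet line-unique (no-isolated⇒other em {H = H} none)
      (proj₂ (intersecting⇒edge em {H = H} intersecting))

  covering : (∃ λ v → IsIsolated H v) → ∃ λ t → IsCoveringNumber H t × t ≤ r ∸ 1
  covering (v , _ , e , e∈E , v∈e , alone) with edge-consecutive e∈E
  ... | _ , _ , (xs , unique , refl , e⇔xs) , _ =
    let t , cover , ≤-all = least em (λ t → ∃ λ C → IsCover H C × HasSize C t) (_ , C-cover)
    in t , (cover , λ C k C-covers size → ≤-all k (C , C-covers , size)) ,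
       ℕ.≤-trans (≤-all _ C-cover) (ℕ.<⇒≤pred (filter-notAll ≢v? xs v-removed))
    where
    -- The cover is the edge of the isolated vertex v with v removed, so it has fewer than r points.
    C : Pred ℤ² 0ℓ
    C x = x ∈ e × x ≢ v
    ≢v? : ∀ x → Dec (x ≢ v)
    ≢v? x = ¬? (x ≟ v)
    v-removed : Any (λ x → ¬ x ≢ v) xs
    v-removed = Any.map (λ v≡x x≢v → x≢v (sym v≡x)) (Equivalence.to (e⇔xs v) v∈e)
    C-meets : ∀ {f} → f ∈ E → C ≬ f
    C-meets {f} f∈E with em₀ em {v ∈ f}
    -- An edge through v equals e and so contains the points of e that remain; an edge missing v
    -- meets e elsewhere than at v.
    ... | yes v∈f = let x , x∈e , x≢v , _ = avoid (proj₂ (segment e∈E)) v v in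
      x , (x∈e , x≢v) , proj₂ (alone f∈E v∈f) x∈e
    ... | no v∉f = let x , x∈e , x∈f = meet e∈E f∈E in
      x , (x∈e , λ { refl → v∉f x∈f }) , x∈f
    C⇔ : ∀ x → (x ∈ C) ⇔ (x ∈ₗ filter ≢v? xs)
    C⇔ x = mk⇔
      (λ (x∈e , x≢v) → ∈-filter⁺ ≢v? (Equivalence.to (e⇔xs x) x∈e) x≢v)
      (λ x∈ → let x∈xs , x≢v = ∈-filter⁻ ≢v? x∈ in Equivalence.from (e⇔xs x) x∈xs , x≢v)
    C-cover : ∃ λ C → IsCover H C × HasSize C (length (filter ≢v? xs))
    C-cover = C , ((λ (x∈e , _) → E⊆2^V e∈E x∈e) , C-meets) ,
      filter ≢v? xs , Unique.filter⁺ ≢v? unique , refl , C⇔
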